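{- Bipartite graphs are ideally $[3,4]$-choosable, and $[3,4]$-LISTCOL can be solved in $O(|V|)$ in the class of bipartite graphs.
   Context: All graphs are finite and simple. For a graph $G=(V,E)$ and an assignment of lists $L(v)$ of colors to the vertices, a list coloring is a proper vertex coloring $c$ of $G$ with $c(v)\in L(v)$ for all $v\in V$. For integers $k\ge\ell$, a graph $G=(V,E)$ is ideally $[\ell,k]$-choosable if for every assignment of lists $L(v)\subseteq\{1,\dots,k\}$ with $|L(v)|=\ell$ for all $v\in V$, every vertex $v_0$ and every color $c_0\in L(v_0)$, there is a list coloring $c$ of $G$ with $c(v_0)=c_0$. $[\ell,k]$-LISTCOL is the following decision problem: given a graph $G=(V,E)$ and lists $L(v)\subseteq\{1,\dots,k\}$ with $|L(v)|=\ell$ for all $v\in V$, decide whether there is a list coloring. -}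

module Defs where

open import Data.Bool.Base using (Bool; true; false)
open import Data.Fin.Base using (Fin; toℕ)
open import Data.Fin.Subset using (Subset; _∈_; ∣_∣)
open import Data.Fin.Subset.Properties using (_∈?_)
open import Data.List.Base using (List; []; _∷_; _++_; length; map; concatMap; filter; allFin)
open import Data.List.Scans.Base using (scanl)
open import Data.Maybe.Base using (Maybe; just; nothing)
open import Data.Nat.Base using (ℕ; zero; suc; _+_; _∸_; _*_; _≤_)
open import Data.Nat.Properties using (_≟_)
open import Data.Product.Base using (Σ-syntax; ∃-syntax; _×_)
open import Function.Bundles using (_⇔_)
open import Level using (0ℓ)
open import Relation.Binary.Core using (Rel)
open import Relation.Binary.Definitions using (Decidable; Irreflexive; Symmetric)
open import Relation.Binary.PropositionalEquality.Core using (_≡_; _≢_)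
open import Relation.Nullary.Decidable.Core using (does)

------------------------------------------------------------------------
-- Graphs and list colorings

record Graph (n : ℕ) : Set₁ where
  infix 4 _~_ _~?_
  field
    _~_    : Rel (Fin n) 0ℓ
    sym    : Symmetric _~_
    irrefl : Irreflexive _≡_ _~_
    _~?_   : Decidable _~_

Bipartite : ∀ {n} → Graph n → Set
Bipartite {n} G = Σ[ side ∈ (Fin n → Bool) ] (∀ u v → u ~ v → side u ≢ side v)
  where open Graph G

-- The color set {1,…,k} is represented by Fin k; the color i is the element
-- x with suc (toℕ x) ≡ i.
Lists : ℕ → ℕ → Set
Lists k n = Fin n → Subset k

AllOfSize : ∀ {k n} → ℕ → Lists k n → Set
AllOfSize ℓ L = ∀ v → ∣ L v ∣ ≡ ℓ

ListColoring : ∀ {n k} → Graph n → Lists k n → (Fin n → Fin k) → Set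
ListColoring G L c = (∀ u v → u ~ v → c u ≢ c v) × (∀ v → c v ∈ L v)
  where open Graph G

IdeallyChoosable : ∀ {n} (ℓ k : ℕ) → Graph n → Set
IdeallyChoosable ℓ k G =
  ∀ (L : Lists k _) → AllOfSize ℓ L → ∀ v₀ c₀ → c₀ ∈ L v₀ →
  ∃[ c ] (ListColoring G L c × c v₀ ≡ c₀)

------------------------------------------------------------------------
-- Random access machines with unit cost

-- Registers hold natural numbers and are initially 0. The input is a
-- read-only array of natural numbers with random access, so that a program
-- may run in time less than the length of its input.
data Instr : Set where
  const    : (i a : ℕ)   → Instr  -- Rᵢ ← a
  add      : (i j l : ℕ) → Instr  -- Rᵢ ← Rⱼ + Rₗ
  sub      : (i j l : ℕ) → Instr  -- Rᵢ ← Rⱼ ∸ Rₗ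
  load     : (i j : ℕ)   → Instr  -- Rᵢ ← R at address Rⱼ
  store    : (i j : ℕ)   → Instr  -- R at address Rᵢ ← Rⱼ
  input    : (i j : ℕ)   → Instr  -- Rᵢ ← input at address Rⱼ
  jumpzero : (i a : ℕ)   → Instr  -- if Rᵢ = 0, continue at instruction a
  answer   : Bool        → Instr  -- halt with the given answer

Program : Set
Program = List Instr

Registers : Set
Registers = ℕ → ℕ

_[_≔_] : Registers → ℕ → ℕ → Registers
(R [ i ≔ a ]) j with does (j ≟ i)
... | true  = a
... | false = R j

fetch : ∀ {A : Set} → List A → ℕ → Maybe A
fetch []       _       = nothing
fetch (x ∷ _)  zero    = just x
fetch (_ ∷ xs) (suc i) = fetch xs i

-- Addresses past the end of the input read as 0.
inputAt : List ℕ → ℕ → ℕ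
inputAt []       _       = 0
inputAt (x ∷ _)  zero    = x
inputAt (_ ∷ xs) (suc i) = inputAt xs i

-- runFrom P w t pc R is just b if P, started at instruction pc with
-- registers R on input w, halts with answer b after executing at most t
-- instructions, and nothing otherwise. Leaving the program is not halting.
runFrom : Program → List ℕ → ℕ → ℕ → Registers → Maybe Bool
runFrom P w zero    pc R = nothing
runFrom P w (suc t) pc R with fetch P pc
... | nothing             = nothing
... | just (const i a)    = runFrom P w t (suc pc) (R [ i ≔ a ])
... | just (add i j l)    = runFrom P w t (suc pc) (R [ i ≔ R j + R l ])
... | just (sub i j l)    = runFrom P w t (suc pc) (R [ i ≔ R j ∸ R l ])
... | just (load i j)     = runFrom P w t (suc pc) (R [ i ≔ R (R j) ])
... | just (store i j)    = runFrom P w t (suc pc) (R [ R i ≔ R j ])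
... | just (input i j)    = runFrom P w t (suc pc) (R [ i ≔ inputAt w (R j) ])
... | just (answer b)     = just b
... | just (jumpzero i a) with R i
...   | zero  = runFrom P w t a R
...   | suc _ = runFrom P w t (suc pc) R

run : Program → List ℕ → ℕ → Maybe Bool
run P w t = runFrom P w t 0 (λ _ → 0)

------------------------------------------------------------------------
-- The problem [ℓ,k]-LISTCOL and its complexity

record Instance (ℓ k : ℕ) : Set₁ where
  field
    order : ℕ
    graph : Graph order
    lists : Lists k order
    sizes : AllOfSize ℓ lists

-- The input array consists of
--   * the number n of vertices,
--   * for each vertex, the ℓ colors in its list, as numbers in {1,…,k},
--   * n + 1 offsets, the v-th being the sum of the degrees of the vertices
--     before v,
--   * the concatenated neighbour lists; the one of v lies between the v-th
--     and the (v+1)-st offset.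
encode : ∀ {ℓ k} → Instance ℓ k → List ℕ
encode {k = k} I = order ∷ concatMap colors (allFin order)
                         ++ scanl _+_ 0 (map degree (allFin order))
                         ++ concatMap neighbours (allFin order)
  where
  open Instance I
  open Graph graph
  colors neighbours : Fin order → List ℕ
  colors v     = map (λ x → suc (toℕ x)) (filter (_∈? lists v) (allFin k))
  neighbours v = map toℕ (filter (v ~?_) (allFin order))
  degree : Fin order → ℕ
  degree v = length (neighbours v)

LISTCOL : ∀ {ℓ k} → Instance ℓ k → Set
LISTCOL I = ∃[ c ] ListColoring graph lists c
  where open Instance I

infix 4 _∈O_
_∈O_ : (ℕ → ℕ) → (ℕ → ℕ) → Set
f ∈O g = ∃[ C ] ∃[ N ] (∀ n → N ≤ n → f n ≤ C * g n)

-- Instances whose graph is outside the class 𝒞 are unconstrained: membership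
-- in 𝒞 is promised, and no certificate of it is part of the input.
LISTCOL-SolvableInO : (ℓ k : ℕ) → (∀ {n} → Graph n → Set) → (ℕ → ℕ) → Set₁
LISTCOL-SolvableInO ℓ k 𝒞 f =
  Σ[ P ∈ Program ] Σ[ T ∈ (ℕ → ℕ) ]
    T ∈O f ×
    (∀ (I : Instance ℓ k) → let open Instance I in 𝒞 graph →
      ∃[ b ] (run P (encode I) (T order) ≡ just b × (b ≡ true ⇔ LISTCOL I)))

{-# OPTIONS --safe #-}
-- A 3-element subset of a 4-element set of colors meets every pair of colors.
-- Hence one side of the bipartition can be colored from the pair {c₀, d} and
-- the other side from the complementary pair, and every vertex on the first
-- side with c₀ in its list, v₀ among them, can be given c₀. A list coloring
-- therefore always exists, so the decision problem is solved by answering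
-- "true" without reading the input.
module Submission where

open import Defs
open import Data.Bool.Base using (true)
open import Data.Bool.Properties using (¬-not) renaming (_≟_ to _≟ᵇ_)
open import Data.Fin.Base using (Fin; zero; suc; punchIn)
open import Data.Fin.Properties using (punchInᵢ≢i; punchIn-injective)
open import Data.Fin.Subset using (Subset; inside; outside; _∈_; _∉_; ∣_∣)
open import Data.Fin.Subset.Properties using (_∈?_; ∣p∣≡n⇒p≡⊤; ∈⊤)
open import Data.List.Base using ([]; _∷_)
open import Data.Nat.Base using (ℕ; zero; suc)
open import Data.Nat.Properties using (suc-injective; m≤m+n; ≤-trans)
open import Data.Product.Base using (_×_; _,_; ∃-syntax)
open import Data.Vec.Base using (_∷_; here; there)
open import Function.Base using (_∘_)
open import Function.Bundles using (mk⇔)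
open import Relation.Binary.PropositionalEquality
  using (_≡_; _≢_; refl; sym; trans; cong; subst; ≢-sym)
open import Relation.Nullary using (yes; no; contradiction)

∈-full : ∀ {n} {p : Subset n} x → ∣ p ∣ ≡ n → x ∈ p
∈-full x eq = subst (x ∈_) (sym (∣p∣≡n⇒p≡⊤ eq)) ∈⊤

omits≤1 : ∀ {n} (p : Subset (suc n)) {x y} → ∣ p ∣ ≡ n → x ≢ y → x ∉ p → y ∈ p
omits≤1 (inside ∷ p) {y = zero} _ _ _ = here
omits≤1 (inside ∷ p) {zero} _ _ x∉p = contradiction here x∉p
omits≤1 {suc n} (inside ∷ p) {suc x} {suc y} eq x≢y x∉p =
  there (omits≤1 p (suc-injective eq) (x≢y ∘ cong suc) (x∉p ∘ there))
omits≤1 (outside ∷ p) {zero} {zero} _ x≢y _ = contradiction refl x≢y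
omits≤1 (outside ∷ p) {zero} {suc y} eq _ _ = there (∈-full y eq)
omits≤1 (outside ∷ p) {suc x} eq _ x∉p = contradiction (there (∈-full x eq)) x∉p

prefer : ∀ {k} → Fin k → Fin k → Subset k → Fin k
prefer a b s with a ∈? s
... | yes _ = a
... | no  _ = b

prefer-∈ : ∀ {k} {a b : Fin (suc k)} {s} → ∣ s ∣ ≡ k → a ≢ b → prefer a b s ∈ s
prefer-∈ {a = a} {s = s} eq a≢b with a ∈? s
... | yes a∈s = a∈s
... | no  a∉s = omits≤1 s eq a≢b a∉s

prefer-first : ∀ {k} {a b : Fin k} {s} → a ∈ s → prefer a b s ≡ a
prefer-first {a = a} {s = s} a∈s with a ∈? s
... | yes _   = refl
... | no  a∉s = contradiction a∈s a∉s

prefer-≢ : ∀ {k} {a b x : Fin k} s → a ≢ x → b ≢ x → prefer a b s ≢ x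
prefer-≢ {a = a} s a≢x b≢x with a ∈? s
... | yes _ = a≢x
... | no  _ = b≢x

prefer-disjoint : ∀ {k} {a b c d : Fin k} s t →
  a ≢ c → a ≢ d → b ≢ c → b ≢ d → prefer a b s ≢ prefer c d t
prefer-disjoint s t a≢c a≢d b≢c b≢d =
  ≢-sym (prefer-≢ t (≢-sym (prefer-≢ s a≢c b≢c)) (≢-sym (prefer-≢ s a≢d b≢d)))

bipartite⇒ideallyChoosable : ∀ {n} (G : Graph n) → Bipartite G → IdeallyChoosable 3 4 G
bipartite⇒ideallyChoosable {n} G (side , proper) L sizes v₀ c₀ c₀∈ =
  color , (color-proper , color-∈) , color-v₀
  where
  other : Fin 3 → Fin 4
  other = punchIn c₀

  c₀≢other : ∀ i → c₀ ≢ other i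
  c₀≢other i = ≢-sym (punchInᵢ≢i c₀ i)

  other-≢ : ∀ {i j} → i ≢ j → other i ≢ other j
  other-≢ i≢j = i≢j ∘ punchIn-injective c₀ _ _

  near far : Fin n → Fin 4
  near v = prefer c₀ (other zero) (L v)
  far  v = prefer (other (suc zero)) (other (suc (suc zero))) (L v)

  near≢far : ∀ u v → near u ≢ far v
  near≢far u v = prefer-disjoint (L u) (L v)
    (c₀≢other _) (c₀≢other _) (other-≢ λ ()) (other-≢ λ ())

  color : Fin n → Fin 4
  color v with side v ≟ᵇ side v₀
  ... | yes _ = near v
  ... | no  _ = far v

  color-proper : ∀ u v → Graph._~_ G u v → color u ≢ color v
  color-proper u v u~v with side u ≟ᵇ side v₀ | side v ≟ᵇ side v₀
  ... | yes p | yes q = contradiction (trans p (sym q)) (proper u v u~v)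
  ... | yes _ | no  _ = near≢far u v
  ... | no  _ | yes _ = ≢-sym (near≢far v u)
  ... | no  p | no  q =
    contradiction (trans (¬-not p) (sym (¬-not q))) (proper u v u~v)

  color-∈ : ∀ v → color v ∈ L v
  color-∈ v with side v ≟ᵇ side v₀
  ... | yes _ = prefer-∈ (sizes v) (c₀≢other _)
  ... | no  _ = prefer-∈ (sizes v) (other-≢ λ ())

  color-v₀ : color v₀ ≡ c₀
  color-v₀ with side v₀ ≟ᵇ side v₀
  ... | yes _ = prefer-first c₀∈
  ... | no  p = contradiction refl p

bipartite⇒listColorable : ∀ {n} (G : Graph n) → Bipartite G →
  ∀ L → AllOfSize 3 L → ∃[ c ] ListColoring {k = 4} G L c
bipartite⇒listColorable {zero}  G bip L sizes = (λ ()) , (λ ()) , (λ ())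
bipartite⇒listColorable {suc n} G bip L sizes =
  let c , coloring , _ = bipartite⇒ideallyChoosable G bip L sizes zero
                           (prefer zero (suc zero) (L zero))
                           (prefer-∈ {a = zero} {suc zero} (sizes zero) λ ())
  in c , coloring

proposition3p2 : (∀ {n : ℕ} (G : Graph n) → Bipartite G → IdeallyChoosable 3 4 G)
    × LISTCOL-SolvableInO 3 4 Bipartite (λ n → n)
proposition3p2 =
  bipartite⇒ideallyChoosable ,
  answer true ∷ [] , (λ _ → 1) ,
  (1 , 1 , λ n 1≤n → ≤-trans 1≤n (m≤m+n n 0)) ,
  λ I bip → let open Instance I in
    true , refl , mk⇔ (λ _ → bipartite⇒listColorable graph bip lists sizes) (λ _ → refl)
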